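{- If a judgement $\Gamma\vdash\mathbf t:T$ is derivable in $Add_{str}$ with derivation $\mathcal D$, then $|\Gamma|\vdash_F[\mathbf t]_{\mathcal D}:|T|$ is derivable in System $F$ with pairs.
   Context: Language. Terms and values: $\mathbf t,\mathbf u ::= \mathbf v \mid \mathbf t\,\mathbf u \mid \mathbf t+\mathbf u \mid \mathbf 0$; $\mathbf v ::= x \mid \lambda x.\mathbf t$. Types: $T,R,S ::= U \mid T+R \mid \overline 0$; unit types: $U,V,W ::= X \mid U\to T \mid \forall X.U$. $T[\vec U/\vec X]$ stands for $T[U_1/X_1]\cdots[U_n/X_n]$ (capture-avoiding substitution of unit types for type variables, $X_i$ not free in $U_j$ for $j<i$). A context $\Gamma$ is a set of pairs $x:U$ ($U$ unit) with each term variable appearing at most once. Trees. Trees are given by $\mathcal T,\mathcal T' ::= \ell \mid \mathtt Z \mid \mathtt S(\mathcal T,\mathcal T')$. An $\ell$-leaf is denoted by the word over $\{\mathtt l,\mathtt r\}$ (left/right) giving the path from the root to it. If $s$ is a partial function from $\{\mathtt l,\mathtt r\}^*$ to types defined on every $\ell$-leaf of $\mathcal T$, then $\mathcal T[s]=\mathcal T[w\mapsto s(w)]$ is the type obtained from $\mathcal T$ by replacing each $\ell$-leaf $w$ by $s(w)$, each $\mathtt Z$ by $\overline 0$, and each node $\mathtt S$ by $+$. The composition $\mathcal T\circ\mathcal T'$ is the tree obtained by grafting $\mathcal T'$ at each $\ell$-leaf of $\mathcal T$; its $\ell$-leaves are the words $wv$ with $w$ an $\ell$-leaf of $\mathcal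 T$ and $v$ an $\ell$-leaf of $\mathcal T'$. System $Add_{str}$ (no type equivalence). Rules: (ax) $\Gamma,x:U\vdash x:U$. (ax$_{\overline 0}$) $\Gamma\vdash\mathbf 0:\overline 0$. ($\to_I$) from $\Gamma,x:U\vdash\mathbf t:T$ infer $\Gamma\vdash\lambda x.\mathbf t:U\to T$. ($+_I$) from $\Gamma\vdash\mathbf t:T$ and $\Gamma\vdash\mathbf u:R$ infer $\Gamma\vdash\mathbf t+\mathbf u:T+R$. ($\forall_I$) from $\Gamma\vdash\mathbf t:U$ and $X\notin FV(\Gamma)$ infer $\Gamma\vdash\mathbf t:\forall X.U$. ($\forall_E$) from $\Gamma\vdash\mathbf t:\forall X.U$ infer $\Gamma\vdash\mathbf t:U[V/X]$. ($\to_{E'}$) from $\Gamma\vdash\mathbf t:\mathcal T[w\mapsto\forall\vec X.(U\to T_w)]$ and $\Gamma\vdash\mathbf u:\mathcal T'[v\mapsto U[\vec V_v/\vec X]]$ infer $\Gamma\vdash\mathbf t\mathbf u:\mathcal T\circ\mathcal T'[wv\mapsto T_w[\vec V_v/\vec X]]$. System $F$ with pairs (Curry style). Terms: $t,u ::= x \mid \lambda x.t \mid tu \mid \star \mid \langle t,u\rangle \mid \pi_{\mathtt l}(t) \mid \pi_{\mathtt r}(t)$. Types: $A,B ::= X \mid A\Rightarrow B \mid \forall X.A \mid \mathbf 1 \mid A\times B$. Typing rules: $\Delta,x:A\vdash_F x:A$; $\Delta\vdash_F\star:\mathbf 1$; from $\Delta,x:A\vdash_F t:B$ infer $\Delta\vdash_F\lambda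 x.t:A\Rightarrow B$; from $\Delta\vdash_F t:A\Rightarrow B$ and $\Delta\vdash_F u:A$ infer $\Delta\vdash_F tu:B$; from $\Delta\vdash_F t:A$ and $\Delta\vdash_F u:B$ infer $\Delta\vdash_F\langle t,u\rangle:A\times B$; from $\Delta\vdash_F t:A\times B$ infer $\Delta\vdash_F\pi_{\mathtt l}(t):A$ and $\Delta\vdash_F\pi_{\mathtt r}(t):B$; from $\Delta\vdash_F t:A$ with $X\notin FV(\Delta)$ infer $\Delta\vdash_F t:\forall X.A$; from $\Delta\vdash_F t:\forall X.A$ infer $\Delta\vdash_F t:A[B/X]$. For a tree $\mathcal T$ and a partial function $\tau$ from $\{\mathtt l,\mathtt r\}^*$ to terms of System $F$ with pairs (defined on the $\ell$-leaves of $\mathcal T$), $\mathcal T[\tau]$ is the term obtained by replacing each $\ell$-leaf $w$ by $\tau(w)$, each $\mathtt Z$ by $\star$, and each $\mathtt S$ node by a pair. For a word $w=\alpha_1\cdots\alpha_n$, $\pi_{\alpha_1\cdots\alpha_n}(t)=\pi_{\alpha_1}(\pi_{\alpha_2}(\cdots\pi_{\alpha_n}(t)))$, and $\overline w$ is the mirror (reversed) word of $w$. Translation of types: $|X|=X$; $|\overline 0|=\mathbf 1$; $|\forall X.U|=\forall X.|U|$; $|U\to T|=|U|\Rightarrow|T|$; $|T+R|=|T|\times|R|$; extended pointwise to contexts. Translation of a term $\mathbf t$ typed by a derivation $\mathcal D$ of $Add_{str}$, by induction on $\mathcal D$ according to its last rule: (ax) $[x]_{\mathcal D}=x$. (ax$_{\overline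 0}$) $[\mathbf 0]_{\mathcal D}=\star$. ($+_I$), with premises $\mathcal D_1,\mathcal D_2$: $[\mathbf t+\mathbf u]_{\mathcal D}=\langle[\mathbf t]_{\mathcal D_1},[\mathbf u]_{\mathcal D_2}\rangle$. ($\to_I$), with premise $\mathcal D'$: $[\lambda x.\mathbf t]_{\mathcal D}=\lambda x.[\mathbf t]_{\mathcal D'}$. ($\to_{E'}$), with premises $\mathcal D_1$ (for $\mathbf t$), $\mathcal D_2$ (for $\mathbf u$) and trees $\mathcal T,\mathcal T'$ as in the rule: $[\mathbf t\mathbf u]_{\mathcal D}=\mathcal T\circ\mathcal T'[wv\mapsto\pi_{\overline w}([\mathbf t]_{\mathcal D_1})\,\pi_{\overline v}([\mathbf u]_{\mathcal D_2})]$. ($\forall_I$) and ($\forall_E$), with premise $\mathcal D'$: $[\mathbf t]_{\mathcal D}=[\mathbf t]_{\mathcal D'}$. -}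

module Defs where

open import Data.Fin using (Fin; zero; suc)
open import Data.List using (List; []; _∷_; _++_; foldr; reverse)
open import Data.Nat using (ℕ; zero; suc)
open import Data.Product using (_×_; _,_; proj₁; proj₂)
open import Data.Vec as Vec using (Vec; []; _∷_; lookup)
open import Function using (_∘_)
open import Relation.Binary.PropositionalEquality using (_≡_; refl; cong)

------------------------------------------------------------------------
-- Trees

data Tree : Set where
  ℓ : Tree
  Z : Tree
  S : Tree → Tree → Tree

data Dir : Set where
  l r : Dir

Word : Set
Word = List Dir

-- The ℓ-leaves of a tree.  A partial function on words that is defined on
-- every ℓ-leaf of 𝒯 matters only through its values there, so it is
-- represented by a function out of Leaf 𝒯.
data Leaf : Tree → Set where
  here  : Leaf ℓ
  left  : ∀ {𝒯 𝒯′} → Leaf 𝒯  → Leaf (S 𝒯 𝒯′)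
  right : ∀ {𝒯 𝒯′} → Leaf 𝒯′ → Leaf (S 𝒯 𝒯′)

word : ∀ {𝒯} → Leaf 𝒯 → Word
word here      = []
word (left w)  = l ∷ word w
word (right w) = r ∷ word w

-- plug z s 𝒯 f replaces each ℓ-leaf w by f w, each Z by z and each S by s.
plug : {A : Set} → A → (A → A → A) → (𝒯 : Tree) → (Leaf 𝒯 → A) → A
plug z s ℓ        f = f here
plug z s Z        f = z
plug z s (S 𝒯 𝒯′) f = s (plug z s 𝒯 (f ∘ left)) (plug z s 𝒯′ (f ∘ right))

infixr 9 _∘ᵗ_

_∘ᵗ_ : Tree → Tree → Tree
ℓ         ∘ᵗ 𝒯′ = 𝒯′
Z         ∘ᵗ 𝒯′ = Z
(S 𝒯₁ 𝒯₂) ∘ᵗ 𝒯′ = S (𝒯₁ ∘ᵗ 𝒯′) (𝒯₂ ∘ᵗ 𝒯′)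

-- Every ℓ-leaf of 𝒯 ∘ᵗ 𝒯′ is wv for unique ℓ-leaves w of 𝒯 and v of 𝒯′.
split : ∀ 𝒯 {𝒯′} → Leaf (𝒯 ∘ᵗ 𝒯′) → Leaf 𝒯 × Leaf 𝒯′
split ℓ         x         = here , x
split (S 𝒯₁ 𝒯₂) (left x)  = left  (proj₁ (split 𝒯₁ x)) , proj₂ (split 𝒯₁ x)
split (S 𝒯₁ 𝒯₂) (right x) = right (proj₁ (split 𝒯₂ x)) , proj₂ (split 𝒯₂ x)

word-split : ∀ 𝒯 {𝒯′} (x : Leaf (𝒯 ∘ᵗ 𝒯′)) →
             word x ≡ word (proj₁ (split 𝒯 x)) ++ word (proj₂ (split 𝒯 x))
word-split ℓ         x         = refl
word-split (S 𝒯₁ 𝒯₂) (left x)  = cong (l ∷_) (word-split 𝒯₁ x)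
word-split (S 𝒯₁ 𝒯₂) (right x) = cong (r ∷_) (word-split 𝒯₂ x)

-- [ wv ↦ f w v ] on the ℓ-leaves of 𝒯 ∘ᵗ 𝒯′.
onSplit : {A : Set} (𝒯 𝒯′ : Tree) → (Leaf 𝒯 → Leaf 𝒯′ → A) → Leaf (𝒯 ∘ᵗ 𝒯′) → A
onSplit 𝒯 𝒯′ f x = f (proj₁ (split 𝒯 x)) (proj₂ (split 𝒯 x))

------------------------------------------------------------------------
-- System Add_str
--
-- Term and type variables are well-scoped de Bruijn indices: n counts the
-- term variables and k the type variables in scope.

mutual
  data Tm (n : ℕ) : Set where
    val : Val n → Tm n
    _·_ : Tm n → Tm n → Tm n
    _+_ : Tm n → Tm n → Tm n
    𝟎   : Tm n

  data Val (n : ℕ) : Set where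
    var : Fin n → Val n
    ƛ   : Tm (suc n) → Val n

infixr 6 _⇒_
infixl 5 _⊕_

mutual
  data UTy (k : ℕ) : Set where
    var : Fin k → UTy k
    _⇒_ : UTy k → Ty k → UTy k
    ∀′  : UTy (suc k) → UTy k

  data Ty (k : ℕ) : Set where
    ⌊_⌋ : UTy k → Ty k
    _⊕_ : Ty k → Ty k → Ty k
    𝟎̄   : Ty k

liftᵣ : ∀ {j k} → (Fin j → Fin k) → Fin (suc j) → Fin (suc k)
liftᵣ ρ zero    = zero
liftᵣ ρ (suc i) = suc (ρ i)

mutual
  renᵘ : ∀ {j k} → (Fin j → Fin k) → UTy j → UTy k
  renᵘ ρ (var i) = var (ρ i)
  renᵘ ρ (U ⇒ T) = renᵘ ρ U ⇒ ren ρ T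
  renᵘ ρ (∀′ U)  = ∀′ (renᵘ (liftᵣ ρ) U)

  ren : ∀ {j k} → (Fin j → Fin k) → Ty j → Ty k
  ren ρ ⌊ U ⌋   = ⌊ renᵘ ρ U ⌋
  ren ρ (T ⊕ R) = ren ρ T ⊕ ren ρ R
  ren ρ 𝟎̄       = 𝟎̄

Sub : ℕ → ℕ → Set
Sub j k = Fin j → UTy k

lift : ∀ {j k} → Sub j k → Sub (suc j) (suc k)
lift σ zero    = var zero
lift σ (suc i) = renᵘ suc (σ i)

mutual
  subᵘ : ∀ {j k} → Sub j k → UTy j → UTy k
  subᵘ σ (var i) = σ i
  subᵘ σ (U ⇒ T) = subᵘ σ U ⇒ sub σ T
  subᵘ σ (∀′ U)  = ∀′ (subᵘ (lift σ) U)

  sub : ∀ {j k} → Sub j k → Ty j → Ty k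
  sub σ ⌊ U ⌋   = ⌊ subᵘ σ U ⌋
  sub σ (T ⊕ R) = sub σ T ⊕ sub σ R
  sub σ 𝟎̄       = 𝟎̄

single : ∀ {k} → UTy k → Sub (suc k) k
single V zero    = V
single V (suc i) = var i

-- k ▹ m is k + m, computed by adding the outermost of the m binders first,
-- so that X₁ of ∀X₁…∀Xₘ is the variable introduced by the first suc.
_▹_ : ℕ → ℕ → ℕ
k ▹ zero  = k
k ▹ suc m = suc k ▹ m

∀⃗ : ∀ {k} m → UTy (k ▹ m) → UTy k
∀⃗ zero    U = U
∀⃗ (suc m) U = ∀′ (∀⃗ m U)

lifts : ∀ {j k} m → Sub j k → Sub (j ▹ m) (k ▹ m)
lifts zero    σ = σ
lifts (suc m) σ = lifts m (lift σ)

-- T[V₁/X₁]⋯[Vₘ/Xₘ], substituting for the outermost variable X₁ first.  The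
-- Vⱼ live outside the scope of X₁,…,Xₘ, so no Xᵢ is free in any of them.
instᵘ : ∀ {k m} → UTy (k ▹ m) → Vec (UTy k) m → UTy k
instᵘ             U []       = U
instᵘ {m = suc m} U (V ∷ Vs) = instᵘ (subᵘ (lifts m (single V)) U) Vs

inst : ∀ {k m} → Ty (k ▹ m) → Vec (UTy k) m → Ty k
inst             T []       = T
inst {m = suc m} T (V ∷ Vs) = inst (sub (lifts m (single V)) T) Vs

_[_]ᵀ : ∀ {k} (𝒯 : Tree) → (Leaf 𝒯 → Ty k) → Ty k
𝒯 [ s ]ᵀ = plug 𝟎̄ _⊕_ 𝒯 s

Ctx : ℕ → ℕ → Set
Ctx k n = Vec (UTy k) n

infix 3 _⊢_∶_

data _⊢_∶_ {k n : ℕ} (Γ : Ctx k n) : Tm n → Ty k → Set where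
  ax  : (i : Fin n) → Γ ⊢ val (var i) ∶ ⌊ lookup Γ i ⌋
  ax𝟎 : Γ ⊢ 𝟎 ∶ 𝟎̄
  ⇒I  : ∀ {t U T} → U ∷ Γ ⊢ t ∶ T → Γ ⊢ val (ƛ t) ∶ ⌊ U ⇒ T ⌋
  +I  : ∀ {t u T R} → Γ ⊢ t ∶ T → Γ ⊢ u ∶ R → Γ ⊢ t + u ∶ T ⊕ R
  -- Weakening Γ by a fresh type variable renders X ∉ FV(Γ).
  ∀I  : ∀ {t U} → Vec.map (renᵘ suc) Γ ⊢ t ∶ ⌊ U ⌋ → Γ ⊢ t ∶ ⌊ ∀′ U ⌋
  ∀E  : ∀ {t U} (V : UTy k) → Γ ⊢ t ∶ ⌊ ∀′ U ⌋ → Γ ⊢ t ∶ ⌊ subᵘ (single V) U ⌋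
  ⇒E′ : ∀ {t u} (𝒯 𝒯′ : Tree) (m : ℕ) (U : UTy (k ▹ m))
        (T : Leaf 𝒯 → Ty (k ▹ m)) (V : Leaf 𝒯′ → Vec (UTy k) m) →
        Γ ⊢ t ∶ 𝒯 [ (λ w → ⌊ ∀⃗ m (U ⇒ T w) ⌋) ]ᵀ →
        Γ ⊢ u ∶ 𝒯′ [ (λ v → ⌊ instᵘ U (V v) ⌋) ]ᵀ →
        Γ ⊢ t · u ∶ (𝒯 ∘ᵗ 𝒯′) [ onSplit 𝒯 𝒯′ (λ w v → inst (T w) (V v)) ]ᵀ

------------------------------------------------------------------------
-- System F with pairs, Curry style

data FTm (n : ℕ) : Set where
  var   : Fin n → FTm n
  ƛ     : FTm (suc n) → FTm n
  _·_   : FTm n → FTm n → FTm n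
  ⋆     : FTm n
  ⟨_,_⟩ : FTm n → FTm n → FTm n
  π     : Dir → FTm n → FTm n

infixr 7 _⊗_

data FTy (k : ℕ) : Set where
  var : Fin k → FTy k
  _⇒_ : FTy k → FTy k → FTy k
  ∀′  : FTy (suc k) → FTy k
  𝟏   : FTy k
  _⊗_ : FTy k → FTy k → FTy k

renF : ∀ {j k} → (Fin j → Fin k) → FTy j → FTy k
renF ρ (var i) = var (ρ i)
renF ρ (A ⇒ B) = renF ρ A ⇒ renF ρ B
renF ρ (∀′ A)  = ∀′ (renF (liftᵣ ρ) A)
renF ρ 𝟏       = 𝟏
renF ρ (A ⊗ B) = renF ρ A ⊗ renF ρ B

liftF : ∀ {j k} → (Fin j → FTy k) → Fin (suc j) → FTy (suc k)
liftF σ zero    = var zero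
liftF σ (suc i) = renF suc (σ i)

subF : ∀ {j k} → (Fin j → FTy k) → FTy j → FTy k
subF σ (var i) = σ i
subF σ (A ⇒ B) = subF σ A ⇒ subF σ B
subF σ (∀′ A)  = ∀′ (subF (liftF σ) A)
subF σ 𝟏       = 𝟏
subF σ (A ⊗ B) = subF σ A ⊗ subF σ B

singleF : ∀ {k} → FTy k → Fin (suc k) → FTy k
singleF B zero    = B
singleF B (suc i) = var i

FCtx : ℕ → ℕ → Set
FCtx k n = Vec (FTy k) n

infix 3 _⊢F_∶_

data _⊢F_∶_ {k n : ℕ} (Δ : FCtx k n) : FTm n → FTy k → Set where
  ax : (i : Fin n) → Δ ⊢F var i ∶ lookup Δ i
  𝟏I : Δ ⊢F ⋆ ∶ 𝟏
  ⇒I : ∀ {t A B} → A ∷ Δ ⊢F t ∶ B → Δ ⊢F ƛ t ∶ A ⇒ B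
  ⇒E : ∀ {t u A B} → Δ ⊢F t ∶ A ⇒ B → Δ ⊢F u ∶ A → Δ ⊢F t · u ∶ B
  ×I : ∀ {t u A B} → Δ ⊢F t ∶ A → Δ ⊢F u ∶ B → Δ ⊢F ⟨ t , u ⟩ ∶ A ⊗ B
  ×Eₗ : ∀ {t A B} → Δ ⊢F t ∶ A ⊗ B → Δ ⊢F π l t ∶ A
  ×Eᵣ : ∀ {t A B} → Δ ⊢F t ∶ A ⊗ B → Δ ⊢F π r t ∶ B
  ∀I : ∀ {t A} → Vec.map (renF suc) Δ ⊢F t ∶ A → Δ ⊢F t ∶ ∀′ A
  ∀E : ∀ {t A} (B : FTy k) → Δ ⊢F t ∶ ∀′ A → Δ ⊢F t ∶ subF (singleF B) A

_[_]ᶠ : ∀ {n} (𝒯 : Tree) → (Leaf 𝒯 → FTm n) → FTm n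
𝒯 [ τ ]ᶠ = plug ⋆ ⟨_,_⟩ 𝒯 τ

-- π⃗ (α₁ ∷ ⋯ ∷ αₙ ∷ []) t = π α₁ (⋯ (π αₙ t)): the last letter is applied first.
π⃗ : ∀ {n} → Word → FTm n → FTm n
π⃗ w t = foldr π t w

------------------------------------------------------------------------
-- Translation

mutual
  ∣_∣ᵘ : ∀ {k} → UTy k → FTy k
  ∣ var i ∣ᵘ = var i
  ∣ U ⇒ T ∣ᵘ = ∣ U ∣ᵘ ⇒ ∣ T ∣
  ∣ ∀′ U ∣ᵘ  = ∀′ ∣ U ∣ᵘ

  ∣_∣ : ∀ {k} → Ty k → FTy k
  ∣ ⌊ U ⌋ ∣ = ∣ U ∣ᵘ
  ∣ T ⊕ R ∣ = ∣ T ∣ ⊗ ∣ R ∣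
  ∣ 𝟎̄ ∣     = 𝟏

∣_∣ᶜ : ∀ {k n} → Ctx k n → FCtx k n
∣ Γ ∣ᶜ = Vec.map ∣_∣ᵘ Γ

⟦_⟧ : ∀ {k n} {Γ : Ctx k n} {t T} → Γ ⊢ t ∶ T → FTm n
⟦ ax i ⟧     = var i
⟦ ax𝟎 ⟧      = ⋆
⟦ ⇒I D ⟧     = ƛ ⟦ D ⟧
⟦ +I D₁ D₂ ⟧ = ⟨ ⟦ D₁ ⟧ , ⟦ D₂ ⟧ ⟩
⟦ ∀I D ⟧     = ⟦ D ⟧
⟦ ∀E V D ⟧   = ⟦ D ⟧
⟦ ⇒E′ 𝒯 𝒯′ m U T V D₁ D₂ ⟧ =
  (𝒯 ∘ᵗ 𝒯′) [ onSplit 𝒯 𝒯′ (λ w v →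
    π⃗ (reverse (word w)) ⟦ D₁ ⟧ · π⃗ (reverse (word v)) ⟦ D₂ ⟧) ]ᶠ

{-# OPTIONS --safe #-}
module Submission where

-- The proof is by induction on the derivation: each rule is simulated by the
-- corresponding rules of System F.
--
-- * For the quantifier rules, the translation of types commutes with renaming
--   (∣∣ᵘ-ren, ∣∣ᶜ-ren) and with substitution (∣∣ᵘ-sub), so weakened contexts
--   and instances are translated to weakened contexts and instances.
-- * For the application rule, ∣ 𝒯 [ s ]ᵀ ∣ is a nested product of shape 𝒯.
--   Projecting along the path to an ℓ-leaf w therefore yields a term of type
--   ∣ s w ∣ (project-leaf).  On the function side this type is a quantified
--   arrow, which is instantiated by iterated ∀E (∀⃗-elim); it can then be
--   applied to the component projected on the argument side.  The resulting
--   terms, one for each ℓ-leaf of 𝒯 ∘ᵗ 𝒯′, are reassembled by pairing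
--   (pair-leaves).

open import Data.Fin using (Fin; zero; suc)
open import Data.List using ([]; _∷_; reverse)
open import Data.List.Properties using (unfold-reverse; foldr-++)
open import Data.Nat using (ℕ; zero; suc)
open import Data.Product using (proj₁; proj₂)
open import Data.Vec as Vec using (Vec; []; _∷_)
open import Data.Vec.Properties using (map-∘; map-cong; lookup-map)
open import Function using (_∘_)
open import Relation.Binary.PropositionalEquality
  using (_≡_; refl; sym; trans; cong; cong₂; subst; module ≡-Reasoning)

open import Defs

mutual
  ∣∣ᵘ-ren : ∀ {j k} (ρ : Fin j → Fin k) (U : UTy j) →
            ∣ renᵘ ρ U ∣ᵘ ≡ renF ρ ∣ U ∣ᵘ
  ∣∣ᵘ-ren ρ (var i) = refl
  ∣∣ᵘ-ren ρ (U ⇒ T) = cong₂ _⇒_ (∣∣ᵘ-ren ρ U) (∣∣-ren ρ T)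
  ∣∣ᵘ-ren ρ (∀′ U)  = cong ∀′ (∣∣ᵘ-ren (liftᵣ ρ) U)

  ∣∣-ren : ∀ {j k} (ρ : Fin j → Fin k) (T : Ty j) →
           ∣ ren ρ T ∣ ≡ renF ρ ∣ T ∣
  ∣∣-ren ρ ⌊ U ⌋   = ∣∣ᵘ-ren ρ U
  ∣∣-ren ρ (T ⊕ R) = cong₂ _⊗_ (∣∣-ren ρ T) (∣∣-ren ρ R)
  ∣∣-ren ρ 𝟎̄       = refl

∣∣ᶜ-ren : ∀ {j k n} (ρ : Fin j → Fin k) (Γ : Ctx j n) →
          ∣ Vec.map (renᵘ ρ) Γ ∣ᶜ ≡ Vec.map (renF ρ) ∣ Γ ∣ᶜ
∣∣ᶜ-ren ρ Γ = begin
  Vec.map ∣_∣ᵘ (Vec.map (renᵘ ρ) Γ) ≡⟨ map-∘ ∣_∣ᵘ (renᵘ ρ) Γ ⟨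
  Vec.map (∣_∣ᵘ ∘ renᵘ ρ) Γ         ≡⟨ map-cong (∣∣ᵘ-ren ρ) Γ ⟩
  Vec.map (renF ρ ∘ ∣_∣ᵘ) Γ         ≡⟨ map-∘ (renF ρ) ∣_∣ᵘ Γ ⟩
  Vec.map (renF ρ) (Vec.map ∣_∣ᵘ Γ) ∎
  where open ≡-Reasoning

-- The pointwise translation of a substitution is given as a relation between
-- σ and σ′ rather than by the equation σ′ ≡ ∣_∣ᵘ ∘ σ, so that going under a
-- binder needs no function extensionality.
_≈ˢ_ : ∀ {j k} → Sub j k → (Fin j → FTy k) → Set
σ ≈ˢ σ′ = ∀ i → ∣ σ i ∣ᵘ ≡ σ′ i

≈ˢ-lift : ∀ {j k} {σ : Sub j k} {σ′ : Fin j → FTy k} →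
          σ ≈ˢ σ′ → lift σ ≈ˢ liftF σ′
≈ˢ-lift         σ≈σ′ zero    = refl
≈ˢ-lift {σ = σ} σ≈σ′ (suc i) =
  trans (∣∣ᵘ-ren suc (σ i)) (cong (renF suc) (σ≈σ′ i))

≈ˢ-single : ∀ {k} (V : UTy k) → single V ≈ˢ singleF ∣ V ∣ᵘ
≈ˢ-single V zero    = refl
≈ˢ-single V (suc i) = refl

mutual
  ∣∣ᵘ-sub : ∀ {j k} {σ : Sub j k} {σ′ : Fin j → FTy k} → σ ≈ˢ σ′ →
            (U : UTy j) → ∣ subᵘ σ U ∣ᵘ ≡ subF σ′ ∣ U ∣ᵘ
  ∣∣ᵘ-sub σ≈σ′ (var i) = σ≈σ′ i
  ∣∣ᵘ-sub σ≈σ′ (U ⇒ T) = cong₂ _⇒_ (∣∣ᵘ-sub σ≈σ′ U) (∣∣-sub σ≈σ′ T)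
  ∣∣ᵘ-sub σ≈σ′ (∀′ U)  = cong ∀′ (∣∣ᵘ-sub (≈ˢ-lift σ≈σ′) U)

  ∣∣-sub : ∀ {j k} {σ : Sub j k} {σ′ : Fin j → FTy k} → σ ≈ˢ σ′ →
           (T : Ty j) → ∣ sub σ T ∣ ≡ subF σ′ ∣ T ∣
  ∣∣-sub σ≈σ′ ⌊ U ⌋   = ∣∣ᵘ-sub σ≈σ′ U
  ∣∣-sub σ≈σ′ (T ⊕ R) = cong₂ _⊗_ (∣∣-sub σ≈σ′ T) (∣∣-sub σ≈σ′ R)
  ∣∣-sub σ≈σ′ 𝟎̄       = refl

subᵘ-∀⃗ : ∀ {j k} m (σ : Sub j k) (U : UTy (j ▹ m)) →
          subᵘ σ (∀⃗ m U) ≡ ∀⃗ m (subᵘ (lifts m σ) U)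
subᵘ-∀⃗ zero    σ U = refl
subᵘ-∀⃗ (suc m) σ U = cong ∀′ (subᵘ-∀⃗ m (lift σ) U)

-- ∀E on translated types.
∣∀∣-elim : ∀ {k n} {Δ : FCtx k n} {t : FTm n} {U : UTy (suc k)} (V : UTy k) →
           Δ ⊢F t ∶ ∣ ∀′ U ∣ᵘ → Δ ⊢F t ∶ ∣ subᵘ (single V) U ∣ᵘ
∣∀∣-elim {U = U} V D =
  subst (_ ⊢F _ ∶_) (sym (∣∣ᵘ-sub (≈ˢ-single V) U)) (∀E ∣ V ∣ᵘ D)

-- Iterated ∀E.  The substitution for the outermost variable is pushed through
-- the remaining quantifiers at each step, as in instᵘ and inst.
∀⃗-elim : ∀ {k m n} {Δ : FCtx k n} {t : FTm n}
          (U : UTy (k ▹ m)) (T : Ty (k ▹ m)) (Vs : Vec (UTy k) m) →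
          Δ ⊢F t ∶ ∣ ∀⃗ m (U ⇒ T) ∣ᵘ → Δ ⊢F t ∶ ∣ instᵘ U Vs ∣ᵘ ⇒ ∣ inst T Vs ∣
∀⃗-elim             U T []       D = D
∀⃗-elim {m = suc m} U T (V ∷ Vs) D =
  ∀⃗-elim (subᵘ σ U) (sub σ T) Vs
    (subst (λ W → _ ⊢F _ ∶ ∣ W ∣ᵘ) (subᵘ-∀⃗ m (single V) (U ⇒ T))
      (∣∀∣-elim V D))
  where σ = lifts m (single V)

-- Reversing the path makes its first letter the innermost projection.
π⃗-reverse-∷ : ∀ {n} α (w : Word) (t : FTm n) →
  π⃗ (reverse w) (π α t) ≡ π⃗ (reverse (α ∷ w)) t
π⃗-reverse-∷ α w t = sym (trans
  (cong (λ v → π⃗ v t) (unfold-reverse α w))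
  (foldr-++ π t (reverse w) (α ∷ [])))

project-leaf : ∀ {k n} {Δ : FCtx k n} {t : FTm n} {𝒯} {s : Leaf 𝒯 → Ty k} →
  Δ ⊢F t ∶ ∣ 𝒯 [ s ]ᵀ ∣ → (w : Leaf 𝒯) →
  Δ ⊢F π⃗ (reverse (word w)) t ∶ ∣ s w ∣
project-leaf         D here      = D
project-leaf {t = t} D (left w)  =
  subst (_ ⊢F_∶ _) (π⃗-reverse-∷ l (word w) t) (project-leaf (×Eₗ D) w)
project-leaf {t = t} D (right w) =
  subst (_ ⊢F_∶ _) (π⃗-reverse-∷ r (word w) t) (project-leaf (×Eᵣ D) w)

pair-leaves : ∀ {k n} {Δ : FCtx k n} 𝒯 {τ : Leaf 𝒯 → FTm n} {s : Leaf 𝒯 → Ty k} →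
  (∀ w → Δ ⊢F τ w ∶ ∣ s w ∣) → Δ ⊢F 𝒯 [ τ ]ᶠ ∶ ∣ 𝒯 [ s ]ᵀ ∣
pair-leaves ℓ        D = D here
pair-leaves Z        D = 𝟏I
pair-leaves (S 𝒯 𝒯′) D =
  ×I (pair-leaves 𝒯 (D ∘ left)) (pair-leaves 𝒯′ (D ∘ right))

theorem16 : ∀ {k n : ℕ} {Γ : Ctx k n} {t : Tm n} {T : Ty k} (D : Γ ⊢ t ∶ T) → ∣ Γ ∣ᶜ ⊢F ⟦ D ⟧ ∶ ∣ T ∣
theorem16 {Γ = Γ} (ax i) =
  subst (_ ⊢F _ ∶_) (lookup-map i ∣_∣ᵘ Γ) (ax i)
theorem16 ax𝟎        = 𝟏I
theorem16 (⇒I D)     = ⇒I (theorem16 D)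
theorem16 (+I D₁ D₂) = ×I (theorem16 D₁) (theorem16 D₂)
theorem16 {Γ = Γ} (∀I {U = U} D) =
  ∀I (subst (_⊢F ⟦ D ⟧ ∶ ∣ U ∣ᵘ) (∣∣ᶜ-ren suc Γ) (theorem16 D))
theorem16 (∀E V D)   = ∣∀∣-elim V (theorem16 D)
theorem16 (⇒E′ 𝒯 𝒯′ m U T V D₁ D₂) = pair-leaves (𝒯 ∘ᵗ 𝒯′) λ x →
  let w = proj₁ (split 𝒯 x)
      v = proj₂ (split 𝒯 x)
  in ⇒E (∀⃗-elim U (T w) (V v) (project-leaf (theorem16 D₁) w))
        (project-leaf (theorem16 D₂) v)
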